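{- For every odd prime number $p$, the Chebyshev polynomial of the second kind $U_p(x)$, the Morgan-Voyce polynomial (of Fibonacci type) $B_p(x)$ and the Vieta polynomial $V_p(x)$ are reducible over $\mathbb{Q}$, i.e. each is a product of two non-constant polynomials in $\mathbb{Q}[x]$.
   Context: The polynomial sequences are defined, with the following indexing, for $n\ge 2$ by: Chebyshev second kind: $U_0=0$, $U_1=1$, $U_n(x)=2xU_{n-1}(x)-U_{n-2}(x)$; Morgan-Voyce (Fibonacci type): $B_0=0$, $B_1=1$, $B_n(x)=(x+2)B_{n-1}(x)-B_{n-2}(x)$; Vieta: $V_0=0$, $V_1=1$, $V_n(x)=xV_{n-1}(x)-V_{n-2}(x)$. -}

module Defs where

open import Data.Nat.Base using (ℕ; zero; suc)
open import Data.Integer.Base using (+_)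
open import Data.List.Base using (List; []; _∷_; map)
open import Data.Product.Base using (_×_; ∃-syntax)
open import Data.Rational.Base using (ℚ; 0ℚ; 1ℚ; _+_; _*_; -_; _/_)
open import Relation.Binary.PropositionalEquality.Core using (_≡_; _≢_)

infix  4 _≈_
infixl 6 _⊕_ _⊖_
infixl 7 _⊗_

-- ℚ[x]: a₀ ∷ a₁ ∷ … ∷ aₙ ∷ [] stands for a₀ + a₁ x + … + aₙ xⁿ.  Trailing
-- zeros are allowed, so equality of polynomials is _≈_ rather than _≡_.
Poly : Set
Poly = List ℚ

coeff : Poly → ℕ → ℚ
coeff []      _       = 0ℚ
coeff (a ∷ f) zero    = a
coeff (a ∷ f) (suc i) = coeff f i

_≈_ : Poly → Poly → Set
f ≈ g = ∀ i → coeff f i ≡ coeff g i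

const : ℚ → Poly
const a = a ∷ []

X : Poly
X = 0ℚ ∷ 1ℚ ∷ []

_⊕_ : Poly → Poly → Poly
[]      ⊕ g       = g
(a ∷ f) ⊕ []      = a ∷ f
(a ∷ f) ⊕ (b ∷ g) = (a + b) ∷ (f ⊕ g)

_⊖_ : Poly → Poly → Poly
f ⊖ g = f ⊕ map -_ g

_⊗_ : Poly → Poly → Poly
[]      ⊗ g = []
(a ∷ f) ⊗ g = map (a *_) g ⊕ (0ℚ ∷ (f ⊗ g))

NonConstant : Poly → Set
NonConstant f = ∃[ i ] coeff f (suc i) ≢ 0ℚ

Reducible : Poly → Set
Reducible f = ∃[ g ] ∃[ h ] (NonConstant g × NonConstant h × f ≈ g ⊗ h)

2ℚ : ℚ
2ℚ = + 2 / 1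

chebyshevU : ℕ → Poly
chebyshevU zero          = const 0ℚ
chebyshevU (suc zero)    = const 1ℚ
chebyshevU (suc (suc n)) = const 2ℚ ⊗ X ⊗ chebyshevU (suc n) ⊖ chebyshevU n

morganVoyceB : ℕ → Poly
morganVoyceB zero          = const 0ℚ
morganVoyceB (suc zero)    = const 1ℚ
morganVoyceB (suc (suc n)) = (X ⊕ const 2ℚ) ⊗ morganVoyceB (suc n) ⊖ morganVoyceB n

vietaV : ℕ → Poly
vietaV zero          = const 0ℚ
vietaV (suc zero)    = const 1ℚ
vietaV (suc (suc n)) = X ⊗ vietaV (suc n) ⊖ vietaV n

{-# OPTIONS --safe #-}

-- A sequence with s₀ = 0, s₁ = 1 and sₙ₊₂ = t sₙ₊₁ − sₙ in a commutative ring satisfies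
-- sₘ₊ₙ₊₁ = sₘ₊₁ sₙ₊₁ − sₘ sₙ.  For m = n = k this is the difference of squares
-- s₂ₖ₊₁ = (sₖ₊₁ − sₖ)(sₖ₊₁ + sₖ).  When t = a + c x with c ≠ 0, the polynomial sₖ₊₁ has
-- degree exactly k, so both factors have degree k, which is positive as soon as 2k+1 > 1.

module Submission where

open import Defs
open import Algebra.Bundles using (AbelianGroup; CommutativeRing)
open import Algebra.Consequences.Setoid using (comm∧idˡ⇒id; comm∧invʳ⇒inv; comm∧distrʳ⇒distr)
import Algebra.Properties.CommutativeSemigroup as CommutativeSemigroupProperties
import Algebra.Properties.Ring as RingProperties
open import Data.Empty using (⊥-elim)
open import Data.List.Base using ([]; _∷_; map)
open import Data.Nat.Base as ℕ using (ℕ; zero; suc; _≤_; z≤n; s≤s)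
open import Data.Nat.Divisibility using (_∣_; ∣m∣n⇒∣m+n; ∣-refl; _∣0)
open import Data.Nat.Primality using (Prime; ¬prime[1])
import Data.Nat.Properties as ℕ
open import Data.Product.Base using (_×_; _,_; ∃-syntax)
open import Data.Rational.Base using (ℚ; 0ℚ; 1ℚ; _+_; _*_; -_; 1/_; ≢-nonZero)
open import Data.Rational.Properties
  using (+-assoc; +-comm; +-identityˡ; +-identityʳ; +-inverseʳ; *-assoc; *-comm; *-identityˡ;
         *-inverseˡ; *-zeroˡ; *-zeroʳ; *-distribˡ-+; *-distribʳ-+)
open import Data.Sum.Base using (_⊎_; inj₁; inj₂)
open import Level using (0ℓ)
open import Relation.Binary.Bundles using (Setoid)
open import Relation.Binary.PropositionalEquality
  using (_≡_; _≢_; refl; sym; trans; cong; cong₂; module ≡-Reasoning)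
import Relation.Binary.Reasoning.Setoid as SetoidReasoning
open import Relation.Nullary.Negation using (¬_)

-- Lucas sequences over a commutative ring

module LucasSequence {c ℓ} (R : CommutativeRing c ℓ) where

  private module R = CommutativeRing R

  open R using () renaming
    (Carrier to A; _≈_ to _≋_; _+_ to _+ᴿ_; _*_ to _*ᴿ_; _-_ to _-ᴿ_; -_ to -ᴿ_; 0# to 0ᴿ; 1# to 1ᴿ)
  open RingProperties R.ring using (x[y-z]≈xy-xz; [y-z]x≈yx-zx; \\-leftDividesʳ; -0#≈0#)
  open CommutativeSemigroupProperties R.*-commutativeSemigroup using (x∙yz≈yx∙z)
  open CommutativeSemigroupProperties R.+-commutativeSemigroup using (xy∙z≈xz∙y)
  open SetoidReasoning R.setoid

  -‿cong₂ : ∀ {w x y z} → w ≋ x → y ≋ z → w -ᴿ y ≋ x -ᴿ z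
  -‿cong₂ p q = R.+-cong p (R.-‿cong q)

  -- The term `u *ᴿ v` is inserted and cancelled; commutativity turns one copy into `v *ᴿ u`, so
  -- that `v -ᴿ u` comes out of both halves.
  difference-of-squares : ∀ u v → v *ᴿ v -ᴿ u *ᴿ u ≋ (v -ᴿ u) *ᴿ (v +ᴿ u)
  difference-of-squares u v = begin
    v *ᴿ v -ᴿ u *ᴿ u
      ≈⟨ R.+-congˡ (\\-leftDividesʳ (u *ᴿ v) _) ⟨
    v *ᴿ v +ᴿ (-ᴿ (u *ᴿ v) +ᴿ (u *ᴿ v -ᴿ u *ᴿ u))
      ≈⟨ R.+-assoc _ _ _ ⟨
    (v *ᴿ v -ᴿ u *ᴿ v) +ᴿ (u *ᴿ v -ᴿ u *ᴿ u)
      ≈⟨ R.+-congˡ (-‿cong₂ (R.*-comm u v) R.refl) ⟩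
    (v *ᴿ v -ᴿ u *ᴿ v) +ᴿ (v *ᴿ u -ᴿ u *ᴿ u)
      ≈⟨ R.+-cong ([y-z]x≈yx-zx v v u) ([y-z]x≈yx-zx u v u) ⟨
    (v -ᴿ u) *ᴿ v +ᴿ (v -ᴿ u) *ᴿ u
      ≈⟨ R.distribˡ (v -ᴿ u) v u ⟨
    (v -ᴿ u) *ᴿ (v +ᴿ u) ∎

  module _ (t : A) (s : ℕ → A) (s-zero : s 0 ≋ 0ᴿ) (s-one : s 1 ≋ 1ᴿ)
           (s-step : ∀ n → s (suc (suc n)) ≋ t *ᴿ s (suc n) -ᴿ s n) where

    -- Induction on `m` for all `n` at once: a unit moves from the first index to the second, and
    -- the recurrence is used once at `n` to expand and once at `m` to contract.
    addition-formula : ∀ m n → s (suc (m ℕ.+ n)) ≋ s (suc m) *ᴿ s (suc n) -ᴿ s m *ᴿ s n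
    addition-formula zero n = begin
      s (suc n)                          ≈⟨ R.+-identityʳ _ ⟨
      s (suc n) +ᴿ 0ᴿ                    ≈⟨ R.+-congˡ -0#≈0# ⟨
      s (suc n) -ᴿ 0ᴿ                    ≈⟨ -‿cong₂ (R.*-identityˡ _) (R.zeroˡ (s n)) ⟨
      1ᴿ *ᴿ s (suc n) -ᴿ 0ᴿ *ᴿ s n       ≈⟨ -‿cong₂ (R.*-congʳ s-one) (R.*-congʳ s-zero) ⟨
      s 1 *ᴿ s (suc n) -ᴿ s 0 *ᴿ s n     ∎
    addition-formula (suc m) n = begin
      s (suc (suc m ℕ.+ n))
        ≡⟨ cong (λ k → s (suc k)) (ℕ.+-suc m n) ⟨
      s (suc (m ℕ.+ suc n))
        ≈⟨ addition-formula m (suc n) ⟩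
      s (suc m) *ᴿ s (suc (suc n)) -ᴿ s m *ᴿ s (suc n)
        ≈⟨ -‿cong₂ (R.*-congˡ (s-step n)) R.refl ⟩
      s (suc m) *ᴿ (t *ᴿ s (suc n) -ᴿ s n) -ᴿ s m *ᴿ s (suc n)
        ≈⟨ -‿cong₂ (x[y-z]≈xy-xz _ _ _) R.refl ⟩
      s (suc m) *ᴿ (t *ᴿ s (suc n)) -ᴿ s (suc m) *ᴿ s n -ᴿ s m *ᴿ s (suc n)
        -- Swapping the two subtracted terms brings together those divisible by `s (suc n)`; their
        -- cofactor is the recurrence for `s (suc (suc m))`.
        ≈⟨ xy∙z≈xz∙y _ _ _ ⟩
      s (suc m) *ᴿ (t *ᴿ s (suc n)) -ᴿ s m *ᴿ s (suc n) -ᴿ s (suc m) *ᴿ s n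
        ≈⟨ -‿cong₂ (-‿cong₂ (x∙yz≈yx∙z _ _ _) R.refl) R.refl ⟩
      t *ᴿ s (suc m) *ᴿ s (suc n) -ᴿ s m *ᴿ s (suc n) -ᴿ s (suc m) *ᴿ s n
        ≈⟨ -‿cong₂ ([y-z]x≈yx-zx _ _ _) R.refl ⟨
      (t *ᴿ s (suc m) -ᴿ s m) *ᴿ s (suc n) -ᴿ s (suc m) *ᴿ s n
        ≈⟨ -‿cong₂ (R.*-congʳ (s-step m)) R.refl ⟨
      s (suc (suc m)) *ᴿ s (suc n) -ᴿ s (suc m) *ᴿ s n ∎

    odd-index-factorisation : ∀ k →
      s (suc (k ℕ.+ k)) ≋ (s (suc k) -ᴿ s k) *ᴿ (s (suc k) +ᴿ s k)
    odd-index-factorisation k =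
      R.trans (addition-formula k k) (difference-of-squares (s k) (s (suc k)))

-- The ring ℚ[x]

coeff-⊕ : ∀ f g i → coeff (f ⊕ g) i ≡ coeff f i + coeff g i
coeff-⊕ []      g       i       = sym (+-identityˡ _)
coeff-⊕ (a ∷ f) []      i       = sym (+-identityʳ _)
coeff-⊕ (a ∷ f) (b ∷ g) zero    = refl
coeff-⊕ (a ∷ f) (b ∷ g) (suc i) = coeff-⊕ f g i

coeff-scale : ∀ a f i → coeff (map (a *_) f) i ≡ a * coeff f i
coeff-scale a []      i       = sym (*-zeroʳ a)
coeff-scale a (b ∷ f) zero    = refl
coeff-scale a (b ∷ f) (suc i) = coeff-scale a f i

coeff-neg : ∀ f i → coeff (map -_ f) i ≡ - coeff f i
coeff-neg []      i       = refl
coeff-neg (b ∷ f) zero    = refl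
coeff-neg (b ∷ f) (suc i) = coeff-neg f i

coeff-⊖ : ∀ f g i → coeff (f ⊖ g) i ≡ coeff f i + - coeff g i
coeff-⊖ f g i = trans (coeff-⊕ f (map -_ g) i) (cong (coeff f i +_) (coeff-neg g i))

-- f ≈ g unfolds to a function type from which f and g cannot be inferred; the record keeps them.
record _≃_ (f g : Poly) : Set where
  constructor coeffwise
  field at : f ≈ g

open _≃_

infix 4 _≃_

≃-setoid : Setoid 0ℓ 0ℓ
≃-setoid = record
  { Carrier = Poly
  ; _≈_ = _≃_
  ; isEquivalence = record
    { refl = coeffwise λ _ → refl
    ; sym = λ p → coeffwise λ i → sym (at p i)
    ; trans = λ p q → coeffwise λ i → trans (at p i) (at q i)
    }
  }

open Setoid ≃-setoid using () renaming (refl to ≃-refl; sym to ≃-sym; trans to ≃-trans)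

∷-cong : ∀ {a b f g} → a ≡ b → f ≃ g → (a ∷ f) ≃ (b ∷ g)
∷-cong p q = coeffwise λ where
  zero    → p
  (suc i) → at q i

-- Links the two forms of zero: the sequences start at `const 0ℚ`, while the ring below has `[]` as
-- its zero.
0∷[]≃[] : const 0ℚ ≃ []
0∷[]≃[] = coeffwise λ where
  zero    → refl
  (suc i) → refl

⊕-cong : ∀ {f f′ g g′} → f ≃ f′ → g ≃ g′ → f ⊕ g ≃ f′ ⊕ g′
⊕-cong {f} {f′} {g} {g′} p q = coeffwise λ i → begin
  coeff (f ⊕ g) i           ≡⟨ coeff-⊕ f g i ⟩
  coeff f i + coeff g i     ≡⟨ cong₂ _+_ (at p i) (at q i) ⟩
  coeff f′ i + coeff g′ i   ≡⟨ coeff-⊕ f′ g′ i ⟨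
  coeff (f′ ⊕ g′) i         ∎
  where open ≡-Reasoning

⊕-comm : ∀ f g → f ⊕ g ≃ g ⊕ f
⊕-comm f g = coeffwise λ i →
  trans (coeff-⊕ f g i) (trans (+-comm (coeff f i) _) (sym (coeff-⊕ g f i)))

⊕-assoc : ∀ f g h → (f ⊕ g) ⊕ h ≃ f ⊕ (g ⊕ h)
⊕-assoc f g h = coeffwise λ i → begin
  coeff ((f ⊕ g) ⊕ h) i                  ≡⟨ coeff-⊕ (f ⊕ g) h i ⟩
  coeff (f ⊕ g) i + coeff h i            ≡⟨ cong (_+ coeff h i) (coeff-⊕ f g i) ⟩
  coeff f i + coeff g i + coeff h i      ≡⟨ +-assoc (coeff f i) _ _ ⟩
  coeff f i + (coeff g i + coeff h i)    ≡⟨ cong (coeff f i +_) (coeff-⊕ g h i) ⟨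
  coeff f i + coeff (g ⊕ h) i            ≡⟨ coeff-⊕ f (g ⊕ h) i ⟨
  coeff (f ⊕ (g ⊕ h)) i                  ∎
  where open ≡-Reasoning

⊕-identityʳ : ∀ f → f ⊕ [] ≃ f
⊕-identityʳ f = ⊕-comm f []

neg-cong : ∀ {f g} → f ≃ g → map -_ f ≃ map -_ g
neg-cong {f} {g} p = coeffwise λ i →
  trans (coeff-neg f i) (trans (cong -_ (at p i)) (sym (coeff-neg g i)))

⊖-inverseʳ : ∀ f → f ⊖ f ≃ []
⊖-inverseʳ f = coeffwise λ i → trans (coeff-⊖ f f i) (+-inverseʳ (coeff f i))

⊕-abelianGroup : AbelianGroup 0ℓ 0ℓ
⊕-abelianGroup = record
  { isAbelianGroup = record
    { isGroup = record
      { isMonoid = record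
        { isSemigroup = record
          { isMagma = record
            { isEquivalence = Setoid.isEquivalence ≃-setoid
            ; ∙-cong = ⊕-cong
            }
          ; assoc = ⊕-assoc
          }
        ; identity = (λ _ → ≃-refl) , ⊕-identityʳ
        }
      ; inverse = comm∧invʳ⇒inv ≃-setoid ⊕-comm ⊖-inverseʳ
      ; ⁻¹-cong = neg-cong
      }
    ; comm = ⊕-comm
    }
  }

open CommutativeSemigroupProperties (AbelianGroup.commutativeSemigroup ⊕-abelianGroup)
  using () renaming (interchange to ⊕-interchange)

scale-cong : ∀ a {f g} → f ≃ g → map (a *_) f ≃ map (a *_) g
scale-cong a {f} {g} p = coeffwise λ i →
  trans (coeff-scale a f i) (trans (cong (a *_) (at p i)) (sym (coeff-scale a g i)))

scale-distribˡ : ∀ a f g → map (a *_) (f ⊕ g) ≃ map (a *_) f ⊕ map (a *_) g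
scale-distribˡ a []      g       = ≃-refl
scale-distribˡ a (b ∷ f) []      = ≃-refl
scale-distribˡ a (b ∷ f) (d ∷ g) = ∷-cong (*-distribˡ-+ a b d) (scale-distribˡ a f g)

scale-distribʳ : ∀ a b f → map ((a + b) *_) f ≃ map (a *_) f ⊕ map (b *_) f
scale-distribʳ a b []      = ≃-refl
scale-distribʳ a b (d ∷ f) = ∷-cong (*-distribʳ-+ d a b) (scale-distribʳ a b f)

scale-assoc : ∀ a b f → map ((a * b) *_) f ≃ map (a *_) (map (b *_) f)
scale-assoc a b []      = ≃-refl
scale-assoc a b (d ∷ f) = ∷-cong (*-assoc a b d) (scale-assoc a b f)

scale-zero : ∀ f → map (0ℚ *_) f ≃ []
scale-zero f = coeffwise λ i → trans (coeff-scale 0ℚ f i) (*-zeroˡ (coeff f i))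

scale-one : ∀ f → map (1ℚ *_) f ≃ f
scale-one f = coeffwise λ i → trans (coeff-scale 1ℚ f i) (*-identityˡ (coeff f i))

⊗-congˡ : ∀ f {g h} → g ≃ h → f ⊗ g ≃ f ⊗ h
⊗-congˡ []      p = ≃-refl
⊗-congˡ (a ∷ f) p = ⊕-cong (scale-cong a p) (∷-cong refl (⊗-congˡ f p))

⊗-zeroʳ : ∀ f → f ⊗ [] ≃ []
⊗-zeroʳ []      = ≃-refl
⊗-zeroʳ (a ∷ f) = ≃-trans (∷-cong refl (⊗-zeroʳ f)) 0∷[]≃[]

-- Mirror image of the defining clause of `_⊗_`, which recurses on the left factor; it drives the
-- induction for commutativity. After the heads, the tails are the same three summands in another
-- order.
⊗-∷ʳ : ∀ f b g → f ⊗ (b ∷ g) ≃ map (b *_) f ⊕ (0ℚ ∷ (f ⊗ g))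
⊗-∷ʳ []      b g = ≃-sym 0∷[]≃[]
⊗-∷ʳ (a ∷ f) b g = ∷-cong (cong (_+ 0ℚ) (*-comm a b)) (begin
  map (a *_) g ⊕ (f ⊗ (b ∷ g))                        ≈⟨ ⊕-cong ≃-refl (⊗-∷ʳ f b g) ⟩
  map (a *_) g ⊕ (map (b *_) f ⊕ (0ℚ ∷ (f ⊗ g)))      ≈⟨ ⊕-assoc (map (a *_) g) _ _ ⟨
  (map (a *_) g ⊕ map (b *_) f) ⊕ (0ℚ ∷ (f ⊗ g))      ≈⟨ ⊕-cong (⊕-comm (map (a *_) g) _) ≃-refl ⟩
  (map (b *_) f ⊕ map (a *_) g) ⊕ (0ℚ ∷ (f ⊗ g))      ≈⟨ ⊕-assoc (map (b *_) f) _ _ ⟩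
  map (b *_) f ⊕ (map (a *_) g ⊕ (0ℚ ∷ (f ⊗ g)))      ∎)
  where open SetoidReasoning ≃-setoid

⊗-comm : ∀ f g → f ⊗ g ≃ g ⊗ f
⊗-comm []      g = ≃-sym (⊗-zeroʳ g)
⊗-comm (a ∷ f) g =
  ≃-trans (⊕-cong ≃-refl (∷-cong refl (⊗-comm f g))) (≃-sym (⊗-∷ʳ g a f))

-- Equal polynomials may be lists of different lengths, which hampers induction on the left factor.
-- Commutativity moves that factor to the right, where `⊗-congˡ` applies.
⊗-cong : ∀ {f f′ g g′} → f ≃ f′ → g ≃ g′ → f ⊗ g ≃ f′ ⊗ g′
⊗-cong {f} {f′} {g} {g′} p q = begin
  f ⊗ g     ≈⟨ ⊗-congˡ f q ⟩
  f ⊗ g′    ≈⟨ ⊗-comm f g′ ⟩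
  g′ ⊗ f    ≈⟨ ⊗-congˡ g′ p ⟩
  g′ ⊗ f′   ≈⟨ ⊗-comm g′ f′ ⟩
  f′ ⊗ g′   ∎
  where open SetoidReasoning ≃-setoid

⊗-distribʳ : ∀ h f g → (f ⊕ g) ⊗ h ≃ (f ⊗ h) ⊕ (g ⊗ h)
⊗-distribʳ h []      g       = ≃-refl
⊗-distribʳ h (a ∷ f) []      = ≃-sym (⊕-identityʳ ((a ∷ f) ⊗ h))
⊗-distribʳ h (a ∷ f) (b ∷ g) = begin
  map ((a + b) *_) h ⊕ (0ℚ ∷ ((f ⊕ g) ⊗ h))
    ≈⟨ ⊕-cong (scale-distribʳ a b h) (∷-cong refl (⊗-distribʳ h f g)) ⟩
  (map (a *_) h ⊕ map (b *_) h) ⊕ ((0ℚ ∷ (f ⊗ h)) ⊕ (0ℚ ∷ (g ⊗ h)))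
    ≈⟨ ⊕-interchange (map (a *_) h) _ _ _ ⟩
  (map (a *_) h ⊕ (0ℚ ∷ (f ⊗ h))) ⊕ (map (b *_) h ⊕ (0ℚ ∷ (g ⊗ h))) ∎
  where open SetoidReasoning ≃-setoid

scale-⊗ : ∀ a f g → map (a *_) f ⊗ g ≃ map (a *_) (f ⊗ g)
scale-⊗ a []      g = ≃-refl
scale-⊗ a (b ∷ f) g = begin
  map ((a * b) *_) g ⊕ (0ℚ ∷ (map (a *_) f ⊗ g))
    -- The zero of the shift is rewritten as `a * 0ℚ`, so that the scaling can be pulled out of the
    -- whole list.
    ≈⟨ ⊕-cong (scale-assoc a b g) (∷-cong (sym (*-zeroʳ a)) (scale-⊗ a f g)) ⟩
  map (a *_) (map (b *_) g) ⊕ map (a *_) (0ℚ ∷ (f ⊗ g))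
    ≈⟨ scale-distribˡ a (map (b *_) g) (0ℚ ∷ (f ⊗ g)) ⟨
  map (a *_) (map (b *_) g ⊕ (0ℚ ∷ (f ⊗ g))) ∎
  where open SetoidReasoning ≃-setoid

⊗-assoc : ∀ f g h → (f ⊗ g) ⊗ h ≃ f ⊗ (g ⊗ h)
⊗-assoc []      g h = ≃-refl
⊗-assoc (a ∷ f) g h = begin
  (map (a *_) g ⊕ (0ℚ ∷ (f ⊗ g))) ⊗ h
    ≈⟨ ⊗-distribʳ h (map (a *_) g) (0ℚ ∷ (f ⊗ g)) ⟩
  (map (a *_) g ⊗ h) ⊕ (map (0ℚ *_) h ⊕ (0ℚ ∷ ((f ⊗ g) ⊗ h)))
    -- The zero head of the shifted list contributes `map (0ℚ *_) h`, which vanishes.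
    ≈⟨ ⊕-cong (scale-⊗ a g h) (⊕-cong (scale-zero h) (∷-cong refl (⊗-assoc f g h))) ⟩
  map (a *_) (g ⊗ h) ⊕ (0ℚ ∷ (f ⊗ (g ⊗ h))) ∎
  where open SetoidReasoning ≃-setoid

⊗-identityˡ : ∀ f → const 1ℚ ⊗ f ≃ f
⊗-identityˡ f =
  ≃-trans (⊕-cong (scale-one f) 0∷[]≃[]) (⊕-identityʳ f)

polyRing : CommutativeRing 0ℓ 0ℓ
polyRing = record
  { Carrier = Poly
  ; _≈_ = _≃_
  ; _+_ = _⊕_
  ; _*_ = _⊗_
  ; -_ = map -_
  ; 0# = []
  ; 1# = const 1ℚ
  ; isCommutativeRing = record
    { isRing = record
      { +-isAbelianGroup = AbelianGroup.isAbelianGroup ⊕-abelianGroup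
      ; *-cong = ⊗-cong
      ; *-assoc = ⊗-assoc
      ; *-identity = comm∧idˡ⇒id ≃-setoid ⊗-comm ⊗-identityˡ
      ; distrib = comm∧distrʳ⇒distr ≃-setoid ⊕-cong ⊗-comm ⊗-distribʳ
      }
    ; *-comm = ⊗-comm
    }
  }

-- Lucas sequences of polynomials with linear parameter

coeff-linear-⊗ : ∀ a c f i →
  coeff ((a ∷ c ∷ []) ⊗ f) (suc i) ≡ a * coeff f (suc i) + c * coeff f i
coeff-linear-⊗ a c f i = begin
  coeff (map (a *_) f ⊕ (0ℚ ∷ (map (c *_) f ⊕ const 0ℚ))) (suc i)
    ≡⟨ coeff-⊕ (map (a *_) f) _ (suc i) ⟩
  coeff (map (a *_) f) (suc i) + coeff (map (c *_) f ⊕ const 0ℚ) i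
    ≡⟨ cong₂ _+_ (coeff-scale a f (suc i))
         -- The extra `const 0ℚ` is the shift of the empty tail of the linear factor.
         (at (≃-trans (⊕-cong ≃-refl 0∷[]≃[]) (⊕-identityʳ (map (c *_) f))) i) ⟩
  a * coeff f (suc i) + coeff (map (c *_) f) i
    ≡⟨ cong (a * coeff f (suc i) +_) (coeff-scale c f i) ⟩
  a * coeff f (suc i) + c * coeff f i ∎
  where open ≡-Reasoning

-- Multiplying by the inverse of `x` would give `y ≡ 0ℚ`. This keeps the leading coefficients, which
-- are powers of `c`, from vanishing.
*-≢0 : ∀ {x y} → x ≢ 0ℚ → y ≢ 0ℚ → x * y ≢ 0ℚ
*-≢0 {x} {y} x≢0 y≢0 xy≡0 = y≢0 (begin
  y                ≡⟨ *-identityˡ y ⟨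
  1ℚ * y           ≡⟨ cong (_* y) (*-inverseˡ x) ⟨
  (1/ x * x) * y   ≡⟨ *-assoc (1/ x) x y ⟩
  1/ x * (x * y)   ≡⟨ cong (1/ x *_) xy≡0 ⟩
  1/ x * 0ℚ        ≡⟨ *-zeroʳ (1/ x) ⟩
  0ℚ               ∎)
  where
  open ≡-Reasoning
  instance _ = ≢-nonZero x≢0

-- The parameter `a + c x` is given by its coefficient list, a form to which `2x`, `x + 2` and `x`
-- all evaluate, so one argument serves the three families.
module LinearParameter (a c : ℚ) (c≢0 : c ≢ 0ℚ) (s : ℕ → Poly)
  (s-zero : s 0 ≈ const 0ℚ) (s-one : s 1 ≈ const 1ℚ)
  (s-step : ∀ n → s (suc (suc n)) ≈ (a ∷ c ∷ []) ⊗ s (suc n) ⊖ s n) where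

  coeff-step : ∀ n i →
    coeff (s (suc (suc n))) (suc i)
      ≡ a * coeff (s (suc n)) (suc i) + c * coeff (s (suc n)) i + - coeff (s n) (suc i)
  coeff-step n i = trans (s-step n (suc i))
    (trans (coeff-⊖ ((a ∷ c ∷ []) ⊗ s (suc n)) (s n) (suc i))
      (cong (_+ - coeff (s n) (suc i)) (coeff-linear-⊗ a c (s (suc n)) i)))

  -- Each step multiplies by a linear polynomial, so the degree grows by at most one and stays below
  -- the index. The induction looks back two steps, as the recurrence does.
  degree-bound : ∀ n {i} → n ≤ i → coeff (s n) i ≡ 0ℚ
  degree-bound zero {i} z≤n = trans (s-zero i) (at 0∷[]≃[] i)
  degree-bound (suc zero) (s≤s z≤n) = s-one _
  degree-bound (suc (suc n)) {suc i} (s≤s n<i) = begin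
    coeff (s (suc (suc n))) (suc i)
      ≡⟨ coeff-step n i ⟩
    a * coeff (s (suc n)) (suc i) + c * coeff (s (suc n)) i + - coeff (s n) (suc i)
      ≡⟨ cong₂ (λ x y → a * x + c * y + - coeff (s n) (suc i))
           (degree-bound (suc n) (ℕ.m≤n⇒m≤1+n n<i)) (degree-bound (suc n) n<i) ⟩
    a * 0ℚ + c * 0ℚ + - coeff (s n) (suc i)
      ≡⟨ cong₂ (λ x y → x + y + - coeff (s n) (suc i)) (*-zeroʳ a) (*-zeroʳ c) ⟩
    0ℚ + 0ℚ + - coeff (s n) (suc i)
      ≡⟨ cong (λ x → 0ℚ + 0ℚ + - x) (degree-bound n (ℕ.m≤n⇒m≤1+n (ℕ.<⇒≤ n<i))) ⟩
    0ℚ ∎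
    where open ≡-Reasoning

  -- At the top index the terms with `a` and with `s n` lie beyond their degree bounds; only the
  -- shift by `c x` survives.
  leading-step : ∀ n → coeff (s (suc (suc n))) (suc n) ≡ c * coeff (s (suc n)) n
  leading-step n = begin
    coeff (s (suc (suc n))) (suc n)
      ≡⟨ coeff-step n n ⟩
    a * coeff (s (suc n)) (suc n) + c * coeff (s (suc n)) n + - coeff (s n) (suc n)
      ≡⟨ cong₂ (λ x y → a * x + c * coeff (s (suc n)) n + - y)
           (degree-bound (suc n) ℕ.≤-refl) (degree-bound n (ℕ.n≤1+n n)) ⟩
    a * 0ℚ + c * coeff (s (suc n)) n + 0ℚ
      ≡⟨ +-identityʳ _ ⟩
    a * 0ℚ + c * coeff (s (suc n)) n
      ≡⟨ cong (_+ c * coeff (s (suc n)) n) (*-zeroʳ a) ⟩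
    0ℚ + c * coeff (s (suc n)) n
      ≡⟨ +-identityˡ _ ⟩
    c * coeff (s (suc n)) n ∎
    where open ≡-Reasoning

  leading-≢0 : ∀ n → coeff (s (suc n)) n ≢ 0ℚ
  leading-≢0 zero    eq with () ← trans (sym (s-one 0)) eq
  leading-≢0 (suc n) eq = *-≢0 c≢0 (leading-≢0 n) (trans (sym (leading-step n)) eq)

  -- The second summand has degree at most `k`, so the coefficient at `suc k` is the leading one of
  -- `s (suc (suc k))`. The witness is `k` because `NonConstant` adds one to its index.
  ⊕-nonConstant : ∀ k → NonConstant (s (suc (suc k)) ⊕ s (suc k))
  ⊕-nonConstant k = k , λ eq → leading-≢0 (suc k) (begin
    u                                ≡⟨ +-identityʳ u ⟨
    u + 0ℚ                           ≡⟨ cong (u +_) (degree-bound (suc k) ℕ.≤-refl) ⟨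
    u + coeff (s (suc k)) (suc k)    ≡⟨ coeff-⊕ (s (suc (suc k))) (s (suc k)) (suc k) ⟨
    coeff (s (suc (suc k)) ⊕ s (suc k)) (suc k) ≡⟨ eq ⟩
    0ℚ                               ∎)
    where
    open ≡-Reasoning
    u = coeff (s (suc (suc k))) (suc k)

  ⊖-nonConstant : ∀ k → NonConstant (s (suc (suc k)) ⊖ s (suc k))
  ⊖-nonConstant k = k , λ eq → leading-≢0 (suc k) (begin
    u                                ≡⟨ +-identityʳ u ⟨
    u + - 0ℚ                         ≡⟨ cong (λ x → u + - x) (degree-bound (suc k) ℕ.≤-refl) ⟨
    u + - coeff (s (suc k)) (suc k)  ≡⟨ coeff-⊖ (s (suc (suc k))) (s (suc k)) (suc k) ⟨
    coeff (s (suc (suc k)) ⊖ s (suc k)) (suc k) ≡⟨ eq ⟩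
    0ℚ                               ∎)
    where
    open ≡-Reasoning
    u = coeff (s (suc (suc k))) (suc k)

  -- The factorisation is taken at `suc k`, giving index `2k + 3`: index 1, where both factors would
  -- be constant, is left out.
  odd-index-reducible : ∀ k → Reducible (s (suc (suc k ℕ.+ suc k)))
  odd-index-reducible k =
    s (suc (suc k)) ⊖ s (suc k) , s (suc (suc k)) ⊕ s (suc k) ,
    ⊖-nonConstant k , ⊕-nonConstant k ,
    at (LucasSequence.odd-index-factorisation polyRing (a ∷ c ∷ []) s
      (≃-trans (coeffwise s-zero) 0∷[]≃[]) (coeffwise s-one) (λ n → coeffwise (s-step n)) (suc k))

-- Odd primes and the three families

even⊎odd : ∀ n → 2 ∣ n ⊎ ∃[ k ] n ≡ suc (k ℕ.+ k)
even⊎odd zero          = inj₁ (2 ∣0)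
even⊎odd (suc zero)    = inj₂ (0 , refl)
even⊎odd (suc (suc n)) with even⊎odd n
... | inj₁ 2∣n        = inj₁ (∣m∣n⇒∣m+n ∣-refl 2∣n)
... | inj₂ (k , refl) = inj₂ (suc k , cong (λ m → suc (suc m)) (sym (ℕ.+-suc k k)))

mainTheorem9 : ∀ (p : ℕ) → Prime p → ¬ (2 ∣ p) → Reducible (chebyshevU p) × Reducible (morganVoyceB p) × Reducible (vietaV p)
mainTheorem9 p p-prime ¬2∣p with even⊎odd p
... | inj₁ 2∣p            = ⊥-elim (¬2∣p 2∣p)
-- Here `p` is 1, the one odd number outside the reach of `odd-index-reducible`.
... | inj₂ (zero , refl)  = ⊥-elim (¬prime[1] p-prime)
... | inj₂ (suc k , refl) = U.odd-index-reducible k , B.odd-index-reducible k , V.odd-index-reducible k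
  where
  -- The parameters are `0 + 2x`, `2 + x` and `0 + x`; the defining recurrences match by evaluation.
  module U = LinearParameter 0ℚ 2ℚ (λ ()) chebyshevU (λ _ → refl) (λ _ → refl) (λ _ _ → refl)
  module B = LinearParameter 2ℚ 1ℚ (λ ()) morganVoyceB (λ _ → refl) (λ _ → refl) (λ _ _ → refl)
  module V = LinearParameter 0ℚ 1ℚ (λ ()) vietaV (λ _ → refl) (λ _ → refl) (λ _ _ → refl)
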